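{- Let $n\geq 3$, let $I_n=\{0,\ldots,n-1\}$, let $a\in I_n$, and let $\mathrm{U}_n\subseteq\{0,1\}^n$ be the set of binary sequences of length $n$ containing exactly one occurrence of $1$. Let $K_a$ be the simplicial complex over $I_n$ whose maximal simplices are the sets $\{a,b,c\}$ with $b,c$ distinct elements of $I_n\setminus\{a\}$. Then $K_a$ is a minimal complex generating $\mathrm{U}_n$.
   Context: All sets are finite (possibly empty). For $f:B^J\to A^I$ write $f_i(x)=f(x)_i$. For $i\in I$, the input window $\mathcal{W}_f(i)$ is the smallest set $W\subseteq J$ (it exists) such that for all $x,y\in B^J$, $x|_W=y|_W$ implies $f_i(x)=f_i(y)$. A simplicial complex (or complex) over $I$ is a collection of subsets of $I$ (its simplices) closed under taking subsets; the empty set is a simplex of every complex. The communication complex $K_f$ of $f$ is the complex over $I$ in which a non-empty $S\subseteq I$ is a simplex iff $\bigcap_{i\in S}\mathcal{W}_f(i)\neq\emptyset$. A complex $K$ over $I$ generates a language $L\subseteq A^I$ if there exist finite sets $B,J$ and a function $f:B^J\to A^I$ with image exactly $L$ and $K_f\subseteq K$. A complex generating $L$ is minimal if no complex strictly contained in it generates $L$. We write $\{0,1\}^n$ for $\{0,1\}^{I_n}$. -}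

module Defs where

open import Data.Bool using (if_then_else_)
open import Data.Fin using (Fin; zero; suc)
open import Data.Fin.Properties as Fin using (all?)
open import Data.Fin.Subset
  using (Subset; _∈_; _⊆_; _∩_; _∪_; ∁; ⁅_⁆; ⋂; Nonempty)
  renaming (⊤ to full; ⊥ to ∅)
open import Data.Fin.Subset.Properties
  using (_∈?_; ∈⊤; ∉⊥; x∈⁅x⁆; x∈⁅y⁆⇒x≡y; x∈∁p⇒x∉p; x∉p⇒x∈∁p; x∈p∩q⁺; x∈p∩q⁻;
         x∈p∪q⁺; x∈p∪q⁻; ∪-comm; ⊆-antisym)
open import Data.List using (List; []; _∷_; map; allFin)
open import Data.List.Membership.Propositional using () renaming (_∈_ to _∈ₗ_)
open import Data.List.Membership.Propositional.Properties using (∈-allFin)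
open import Data.List.Relation.Unary.Any using (here; there)
open import Data.Nat using (ℕ; _≤_; s≤s)
open import Data.Product using (∃; ∃₂; ∃!; _×_; _,_; proj₁; proj₂; map₂)
open import Data.Sum as Sum using (_⊎_; inj₁; inj₂)
open import Data.Vec using (Vec; []; _∷_; lookup; tabulate)
open import Data.Vec.Properties using (lookup∘tabulate)
open import Function using (_∘_)
open import Function.Bundles using (_⇔_; mk⇔)
open import Level using (0ℓ)
open import Relation.Binary.PropositionalEquality
  using (_≡_; _≢_; refl; sym; trans; cong; subst)
open import Relation.Nullary
  using (Dec; yes; no; does; ¬_; contradiction; decidable-stable)
open import Relation.Nullary.Decidable using (map′; _→-dec_)
open import Relation.Unary using (Pred; Decidable) renaming (_⊆_ to _⊆ₚ_; _⊂_ to _⊂ₚ_)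

-- Finite sets are represented by Fin, and the elements of B^J by vectors, so
-- that equality of inputs and of outputs is propositional.

private
  variable
    α β j n : ℕ

Language : ℕ → ℕ → Set₁
Language α n = Pred (Vec (Fin α) n) 0ℓ

Agree : Subset j → Vec (Fin β) j → Vec (Fin β) j → Set
Agree W x y = ∀ k → k ∈ W → lookup x k ≡ lookup y k

Determines : (Vec (Fin β) j → Vec (Fin α) n) → Fin n → Subset j → Set
Determines f i W = ∀ x y → Agree W x y → lookup (f x) i ≡ lookup (f y) i

IsSmallest : Pred (Subset j) 0ℓ → Pred (Subset j) 0ℓ
IsSmallest P W = P W × (∀ W′ → P W′ → W ⊆ W′)

private

  allVec? : ∀ j {P : Pred (Vec (Fin β) j) 0ℓ} → Decidable P → Dec (∀ x → P x)
  allVec? ℕ.zero    P? = map′ (λ p → λ where [] → p) (λ p → p []) (P? [])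
  allVec? (ℕ.suc j) P? =
    map′ (λ p → λ where (b ∷ x) → p b x) (λ p b x → p (b ∷ x))
      (all? λ b → allVec? j λ x → P? (b ∷ x))

  module _ (f : Vec (Fin β) j → Vec (Fin α) n) (i : Fin n) where

    determines? : Decidable (Determines f i)
    determines? W = allVec? _ λ x → allVec? _ λ y →
      (all? λ k → (k ∈? W) →-dec (lookup x k Fin.≟ lookup y k))
        →-dec (lookup (f x) i Fin.≟ lookup (f y) i)

    full-determines : Determines f i full
    full-determines x y x≈y = cong-f (ext x y λ k → x≈y k ∈⊤)
      where
      ext : ∀ {m} (u v : Vec (Fin β) m) → (∀ k → lookup u k ≡ lookup v k) → u ≡ v
      ext []      []      e = refl
      ext (_ ∷ u) (_ ∷ v) e with refl ← e zero | refl ← ext u v (e ∘ suc) = refl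
      cong-f : ∀ {u v} → u ≡ v → lookup (f u) i ≡ lookup (f v) i
      cong-f refl = refl

    ∩-determines : ∀ V W → Determines f i V → Determines f i W → Determines f i (V ∩ W)
    ∩-determines V W dV dW x y x≈y = trans (dV x z x≈z) (dW z y z≈y)
      where
      g : Fin _ → Fin _
      g k = if does (k ∈? V) then lookup x k else lookup y k
      z = tabulate g
      x≈z : Agree V x z
      x≈z k k∈V rewrite lookup∘tabulate g k with k ∈? V
      ... | yes _   = refl
      ... | no  k∉V = contradiction k∈V k∉V
      z≈y : Agree W z y
      z≈y k k∈W rewrite lookup∘tabulate g k with k ∈? V
      ... | yes k∈V = x≈y k (x∈p∩q⁺ (k∈V , k∈W))
      ... | no  _   = refl

    -- Omits k exactly when f_i does not depend on the input at k.
    drop : Fin j → Subset j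
    drop k = if does (determines? (∁ ⁅ k ⁆)) then ∁ ⁅ k ⁆ else full

    drop-determines : ∀ k → Determines f i (drop k)
    drop-determines k with determines? (∁ ⁅ k ⁆)
    ... | yes d = d
    ... | no  _ = full-determines

    drop-⊆ : ∀ k W → Determines f i W → k ∈ drop k → k ∈ W
    drop-⊆ k W dW k∈ with determines? (∁ ⁅ k ⁆)
    ... | yes _ = contradiction (x∈⁅x⁆ k) (x∈∁p⇒x∉p k∈)
    ... | no ¬d = decidable-stable (k ∈? W) λ k∉W → ¬d λ x y x≈y →
      dW x y λ l l∈W → x≈y l (x∉p⇒x∈∁p λ l∈⁅k⁆ →
        k∉W (subst (_∈ W) (x∈⁅y⁆⇒x≡y k l∈⁅k⁆) l∈W))

    ⋂-determines : ∀ ks → Determines f i (⋂ (map drop ks))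
    ⋂-determines []       = full-determines
    ⋂-determines (k ∷ ks) = ∩-determines (drop k) (⋂ (map drop ks)) (drop-determines k) (⋂-determines ks)

    ∈⋂ : ∀ {k l} ks → l ∈ₗ ks → k ∈ ⋂ (map drop ks) → k ∈ drop l
    ∈⋂ (l ∷ ks) (here refl) k∈ = proj₁ (x∈p∩q⁻ (drop l) _ k∈)
    ∈⋂ (l ∷ ks) (there l∈)  k∈ = ∈⋂ ks l∈ (proj₂ (x∈p∩q⁻ (drop l) _ k∈))

smallestWindow : (f : Vec (Fin β) j → Vec (Fin α) n) (i : Fin n) →
                 ∃ (IsSmallest (Determines f i))
smallestWindow {j = j} f i =
  ⋂ (map (drop f i) (allFin j)) ,
  ⋂-determines f i (allFin j) ,
  λ W dW {k} k∈ → drop-⊆ f i k W dW (∈⋂ f i (allFin j) (∈-allFin k) k∈)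

inputWindow : (Vec (Fin β) j → Vec (Fin α) n) → Fin n → Subset j
inputWindow f i = proj₁ (smallestWindow f i)

record Complex (n : ℕ) : Set₁ where
  field
    Simplex   : Pred (Subset n) 0ℓ
    ∅-simplex : Simplex ∅
    closed    : ∀ {S T} → S ⊆ T → Simplex T → Simplex S

open Complex public

_≤ᶜ_ _<ᶜ_ : Complex n → Complex n → Set
K ≤ᶜ L = Simplex K ⊆ₚ Simplex L
K <ᶜ L = Simplex K ⊂ₚ Simplex L

IsMaximalSimplex : Complex n → Subset n → Set
IsMaximalSimplex K S = Simplex K S × (∀ T → Simplex K T → S ⊆ T → S ≡ T)

communicationComplex : (Vec (Fin β) j → Vec (Fin α) n) → Complex n
communicationComplex f = record
  { Simplex   = λ S → Nonempty S → ∃ λ k → ∀ i → i ∈ S → k ∈ inputWindow f i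
  ; ∅-simplex = λ (_ , i∈∅) → contradiction i∈∅ ∉⊥
  ; closed    = λ S⊆T T-simplex (i , i∈S) →
      map₂ (λ k∈ l l∈S → k∈ l (S⊆T l∈S)) (T-simplex (i , S⊆T i∈S))
  }

HasImage : (Vec (Fin β) j → Vec (Fin α) n) → Language α n → Set
HasImage f L = ∀ v → L v ⇔ ∃ λ x → f x ≡ v

Generates : Complex n → Language α n → Set
Generates {n} {α} K L =
  ∃₂ λ β j → ∃ λ (f : Vec (Fin β) j → Vec (Fin α) n) →
    HasImage f L × communicationComplex f ≤ᶜ K

IsMinimalGenerating : Complex n → Language α n → Set₁
IsMinimalGenerating K L =
  Generates K L × (∀ K′ → K′ <ᶜ K → ¬ Generates K′ L)

U : ∀ n → Language 2 n
U n v = ∃! _≡_ λ i → lookup v i ≡ suc zero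

IsTriple : Fin n → Subset n → Set
IsTriple a S = ∃₂ λ b c →
  b ≢ a × c ≢ a × b ≢ c × S ≡ ⁅ a ⁆ ∪ ⁅ b ⁆ ∪ ⁅ c ⁆

-- Over a finite vertex set, K is determined by its maximal simplices; such a K
-- exists by Kₐ-exists.
IsKₐ : Fin n → Complex n → Set
IsKₐ a K = ∀ S → IsMaximalSimplex K S ⇔ IsTriple a S

private

  triple-⊆⇒≡ : ∀ {a : Fin n} {S T} → IsTriple a S → IsTriple a T → S ⊆ T → S ≡ T
  triple-⊆⇒≡ {a = a} (b , c , b≢a , c≢a , b≢c , refl) (d , e , _ , _ , _ , refl) S⊆T
    with split b≢a (S⊆T (x∈p∪q⁺ (inj₂ (x∈p∪q⁺ (inj₁ (x∈⁅x⁆ b))))))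
       | split c≢a (S⊆T (x∈p∪q⁺ (inj₂ (x∈p∪q⁺ (inj₂ (x∈⁅x⁆ c))))))
    where
    split : ∀ {x} → x ≢ a → x ∈ ⁅ a ⁆ ∪ ⁅ d ⁆ ∪ ⁅ e ⁆ → x ≡ d ⊎ x ≡ e
    split x≢a x∈ with x∈p∪q⁻ ⁅ a ⁆ _ x∈
    ... | inj₁ x∈a = contradiction (x∈⁅y⁆⇒x≡y a x∈a) x≢a
    ... | inj₂ x∈de = Sum.map (x∈⁅y⁆⇒x≡y d) (x∈⁅y⁆⇒x≡y e) (x∈p∪q⁻ ⁅ d ⁆ ⁅ e ⁆ x∈de)
  ... | inj₁ refl | inj₂ refl = refl
  ... | inj₂ refl | inj₁ refl = cong (⁅ a ⁆ ∪_) (∪-comm ⁅ b ⁆ ⁅ c ⁆)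
  ... | inj₁ refl | inj₁ refl = contradiction refl b≢c
  ... | inj₂ refl | inj₂ refl = contradiction refl b≢c

  triple-exists : 3 ≤ n → (a : Fin n) → ∃ (IsTriple a)
  triple-exists (s≤s (s≤s (s≤s _))) zero =
    _ , suc zero , suc (suc zero) , (λ ()) , (λ ()) , (λ ()) , refl
  triple-exists (s≤s (s≤s (s≤s _))) (suc zero) =
    _ , zero , suc (suc zero) , (λ ()) , (λ ()) , (λ ()) , refl
  triple-exists (s≤s (s≤s (s≤s _))) (suc (suc _)) =
    _ , zero , suc zero , (λ ()) , (λ ()) , (λ ()) , refl

Kₐ-exists : 3 ≤ n → (a : Fin n) → ∃ (IsKₐ a)
Kₐ-exists 3≤n a = K , λ S → mk⇔ to from
  where
  K : Complex _
  K = record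
    { Simplex   = λ S → ∃ λ T → IsTriple a T × S ⊆ T
    ; ∅-simplex = map₂ (_, λ i∈∅ → contradiction i∈∅ ∉⊥) (triple-exists 3≤n a)
    ; closed    = λ S⊆T (V , tV , T⊆V) → V , tV , λ i∈S → T⊆V (S⊆T i∈S)
    }
  to : ∀ {S} → IsMaximalSimplex K S → IsTriple a S
  to ((T , tT , S⊆T) , max) = subst (IsTriple a) (sym (max T (T , tT , λ i → i) S⊆T)) tT
  from : ∀ {S} → IsTriple a S → IsMaximalSimplex K S
  from {S} tS = (S , tS , λ i → i) , λ T (V , tV , T⊆V) S⊆T →
    ⊆-antisym S⊆T λ i∈T →
      subst (_ ∈_) (sym (triple-⊆⇒≡ tS tV (λ i∈S → T⊆V (S⊆T i∈S)))) (T⊆V i∈T)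

{-# OPTIONS --safe #-}
-- Generation: for every ordered pair (b , c) there is an input x_bc, ranging
-- over I_n and seen by a, b and c only.  A coordinate b ≢ a outputs 1 iff
-- x_bc ≡ x_cb ≡ b for all c; two distinct b, b′ would disagree on x_bb′, so at
-- most one of them does, and a outputs 1 iff none does.
--
-- Minimality: let f generate U_n with K_f ⊆ K_a, and suppose {a,b,c} ∉ K_f.  As
-- a triple of K_a containing b, c and a third i ≢ a does not exist, the inputs
-- in V = W(b) ∩ W(c) are seen by b and c alone.  Choose x, y, w such that f has
-- its 1 at b, c, a respectively.  Replacing w by y on V leaves f_a equal to 1, so
-- f_c = 0 there.  Replacing w by x on W(b) gives f_b = 1 and all other outputs 0.
-- Replacing w by x on W(b) ∖ V and by y on V changes none of these others except
-- c, which sees what it saw in the first replacement; so f_b is still 1.  Hence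
-- replacing x by y on W(c) yields f_b = f_c = 1, a contradiction.
module Submission where

open import Defs
open import Data.Bool using (Bool; if_then_else_)
open import Data.Nat using (ℕ; _≤_; s≤s; _*_)
open import Data.Fin using (Fin; zero; suc; combine; remQuot)
open import Data.Fin.Properties using (_≟_; all?; any?; combine-injectiveˡ; combine-injectiveʳ; combine-remQuot)
open import Data.Fin.Subset using (Subset; _∈_; _∉_; _⊆_; _⊃_; _∩_; _∪_; ∁; ⁅_⁆)
open import Data.Fin.Subset.Induction using (Acc; acc; ⊃-wellFounded)
open import Data.Fin.Subset.Properties
  using (_∈?_; nonempty?; x∈⁅x⁆; x∈⁅y⁆⇒x≡y; x∈∁p⇒x∉p; x∉p⇒x∈∁p; x∈p∩q⁺; x∈p∩q⁻; x∈p∪q⁺; x∈p∪q⁻; ⊆-antisym)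
open import Data.Product using (∃; _×_; _,_; proj₁; proj₂)
open import Data.Sum using (_⊎_; inj₁; inj₂; [_,_])
open import Data.Vec using (Vec; lookup; tabulate; replicate)
open import Data.Vec.Properties using (lookup∘tabulate; tabulate∘lookup; tabulate-cong; lookup-replicate)
open import Function using (_∘_; id)
open import Function.Bundles using (mk⇔; module Equivalence)
open import Relation.Binary.PropositionalEquality using (_≡_; _≢_; refl; sym; trans; cong; subst; module ≡-Reasoning)
open import Relation.Nullary using (Dec; yes; no; does; ¬_; contradiction; decidable-stable)
open import Relation.Nullary.Decidable using (_×-dec_; _⊎-dec_; _→-dec_; ¬?; does-⇔; dec-true)

private
  variable
    α β j n : ℕ
    a b c i : Fin n

-- Triples and simplices

∈-triple⁺ : i ≡ a ⊎ i ≡ b ⊎ i ≡ c → i ∈ ⁅ a ⁆ ∪ ⁅ b ⁆ ∪ ⁅ c ⁆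
∈-triple⁺ (inj₁ refl)        = x∈p∪q⁺ (inj₁ (x∈⁅x⁆ _))
∈-triple⁺ (inj₂ (inj₁ refl)) = x∈p∪q⁺ (inj₂ (x∈p∪q⁺ (inj₁ (x∈⁅x⁆ _))))
∈-triple⁺ (inj₂ (inj₂ refl)) = x∈p∪q⁺ (inj₂ (x∈p∪q⁺ (inj₂ (x∈⁅x⁆ _))))

∈-triple⁻ : i ∈ ⁅ a ⁆ ∪ ⁅ b ⁆ ∪ ⁅ c ⁆ → i ≡ a ⊎ i ≡ b ⊎ i ≡ c
∈-triple⁻ {a = a} {b} {c} i∈ with x∈p∪q⁻ ⁅ a ⁆ _ i∈
... | inj₁ i∈a = inj₁ (x∈⁅y⁆⇒x≡y a i∈a)
... | inj₂ i∈bc with x∈p∪q⁻ ⁅ b ⁆ ⁅ c ⁆ i∈bc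
...   | inj₁ i∈b = inj₂ (inj₁ (x∈⁅y⁆⇒x≡y b i∈b))
...   | inj₂ i∈c = inj₂ (inj₂ (x∈⁅y⁆⇒x≡y c i∈c))

third-element : 3 ≤ n → (p q : Fin n) → ∃ λ r → r ≢ p × r ≢ q
third-element (s≤s (s≤s (s≤s _))) zero          zero          = suc zero , (λ ()) , (λ ())
third-element (s≤s (s≤s (s≤s _))) zero          (suc zero)    = suc (suc zero) , (λ ()) , (λ ())
third-element (s≤s (s≤s (s≤s _))) zero          (suc (suc _)) = suc zero , (λ ()) , (λ ())
third-element (s≤s (s≤s (s≤s _))) (suc zero)    zero          = suc (suc zero) , (λ ()) , (λ ())
third-element (s≤s (s≤s (s≤s _))) (suc (suc _)) zero          = suc zero , (λ ()) , (λ ())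
third-element (s≤s (s≤s (s≤s _))) (suc _)       (suc _)       = zero , (λ ()) , (λ ())

avoiding : 3 ≤ n → (p q x : Fin n) → ∃ λ y → y ≢ p × y ≢ q × (x ≡ p ⊎ x ≡ q ⊎ x ≡ y)
avoiding 3≤n p q x with x ≟ p | x ≟ q | third-element 3≤n p q
... | yes x≡p | _       | y , y≢p , y≢q = y , y≢p , y≢q , inj₁ x≡p
... | no _    | yes x≡q | y , y≢p , y≢q = y , y≢p , y≢q , inj₂ (inj₁ x≡q)
... | no x≢p  | no x≢q  | _             = x , x≢p , x≢q , inj₂ (inj₂ refl)

-- `b` and `c` may equal each other or `a`; a vertex that repeats an earlier one is replaced by a
-- fresh one, so that a genuine triple results.
triple-containing : 3 ≤ n → (a b c : Fin n) → ∃ λ T → IsTriple a T × ⁅ a ⁆ ∪ ⁅ b ⁆ ∪ ⁅ c ⁆ ⊆ T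
triple-containing 3≤n a b c with avoiding 3≤n a a b
... | b′ , b′≢a , _ , b∈ with avoiding 3≤n a b′ c
...   | c′ , c′≢a , c′≢b′ , c∈ =
  _ , (b′ , c′ , b′≢a , c′≢a , c′≢b′ ∘ sym , refl) , ∈-triple⁺ ∘ widen ∘ ∈-triple⁻
  where
  widen : ∀ {i} → i ≡ a ⊎ i ≡ b ⊎ i ≡ c → i ≡ a ⊎ i ≡ b′ ⊎ i ≡ c′
  widen (inj₁ i≡a)         = inj₁ i≡a
  widen (inj₂ (inj₁ refl)) = [ inj₁ , [ inj₁ , inj₂ ∘ inj₁ ] ] b∈
  widen (inj₂ (inj₂ refl)) = c∈

-- Being a simplex of K is not decidable, hence the double negation.
¬¬maximal-above : ∀ (K : Complex n) {S} → Simplex K S → ¬ ¬ ∃ λ T → IsMaximalSimplex K T × S ⊆ T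
¬¬maximal-above K sS = go sS (⊃-wellFounded _)
  where
  go : ∀ {S} → Simplex K S → Acc _⊃_ S → ¬ ¬ ∃ λ T → IsMaximalSimplex K T × S ⊆ T
  go {S} sS (acc rs) none = none (S , (sS , maximal) , id)
    where
    maximal : ∀ T → Simplex K T → S ⊆ T → S ≡ T
    -- A point `i` of `T` outside `S` makes `T` strictly larger, so the recursion applies to `T`; a
    -- maximal simplex above `T` also lies above `S`.
    maximal T sT S⊆T = ⊆-antisym S⊆T λ {i} i∈T → decidable-stable (i ∈? S) λ i∉S →
      go sT (rs (S⊆T , i , i∈T , i∉S)) λ (M , M-max , T⊆M) → none (M , M-max , T⊆M ∘ S⊆T)

-- Input windows

window-determines : (f : Vec (Fin β) j → Vec (Fin α) n) (i : Fin n) → Determines f i (inputWindow f i)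
window-determines f i = proj₁ (proj₂ (smallestWindow f i))

∉-window : (f : Vec (Fin β) j → Vec (Fin α) n) {i : Fin n} {k : Fin j} →
           Determines f i (∁ ⁅ k ⁆) → k ∉ inputWindow f i
∉-window f {i} {k} d k∈W = x∈∁p⇒x∉p (proj₂ (proj₂ (smallestWindow f i)) (∁ ⁅ k ⁆) d k∈W) (x∈⁅x⁆ k)

-- For non-empty `S` the condition is a finite search over inputs, hence decidable. This discharges
-- the double negations that an undecidable `K` forces.
communication-stable : (f : Vec (Fin β) j → Vec (Fin α) n) {S : Subset n} →
  ¬ ¬ Simplex (communicationComplex f) S → Simplex (communicationComplex f) S
communication-stable f {S} ¬¬s ne = decidable-stable
  (any? λ k → all? λ i → (i ∈? S) →-dec (k ∈? inputWindow f i))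
  (λ ¬s → ¬¬s λ s → ¬s (s ne))

merge : Subset j → Vec (Fin β) j → Vec (Fin β) j → Vec (Fin β) j
merge S u v = tabulate λ k → if does (k ∈? S) then lookup u k else lookup v k

module _ {S : Subset j} (u v : Vec (Fin β) j) {k : Fin j} where

  lookup-merge-∈ : k ∈ S → lookup (merge S u v) k ≡ lookup u k
  lookup-merge-∈ k∈S rewrite lookup∘tabulate (λ l → if does (l ∈? S) then lookup u l else lookup v l) k
    with k ∈? S
  ... | yes _   = refl
  ... | no  k∉S = contradiction k∈S k∉S

  lookup-merge-∉ : k ∉ S → lookup (merge S u v) k ≡ lookup v k
  lookup-merge-∉ k∉S rewrite lookup∘tabulate (λ l → if does (l ∈? S) then lookup u l else lookup v l) k
    with k ∈? S
  ... | yes k∈S = contradiction k∈S k∉S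
  ... | no  _   = refl

-- Sequences with exactly one 1

lookup-extensional : {u v : Vec (Fin α) n} → (∀ i → lookup u i ≡ lookup v i) → u ≡ v
lookup-extensional {u = u} {v} u≗v = trans (sym (tabulate∘lookup u)) (trans (tabulate-cong u≗v) (tabulate∘lookup v))

U-injective : (v : Vec (Fin 2) n) → U n v → ∀ {i k} → lookup v i ≡ suc zero → lookup v k ≡ suc zero → i ≡ k
U-injective v (_ , _ , unique) vi vk = trans (sym (unique vi)) (unique vk)

≢1⇒≡0 : {t : Fin 2} → t ≢ suc zero → t ≡ zero
≢1⇒≡0 {zero}     _   = refl
≢1⇒≡0 {suc zero} t≢1 = contradiction refl t≢1

U-determined : {u v : Vec (Fin 2) n} → U n u → U n v → lookup u i ≡ suc zero → lookup v i ≡ suc zero → u ≡ v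
U-determined {i = i} {u = u} {v} Uu Uv ui vi = lookup-extensional same
  where
  same : ∀ k → lookup u k ≡ lookup v k
  same k with i ≟ k
  ... | yes refl = trans ui (sym vi)
  ... | no  i≢k  = trans (≢1⇒≡0 (i≢k ∘ U-injective u Uu ui)) (sym (≢1⇒≡0 (i≢k ∘ U-injective v Uv vi)))

indicator : ∀ i → ∃ λ (v : Vec (Fin 2) n) → lookup v i ≡ suc zero × U n v
indicator {n = n} i = v , vi , i , vi , unique
  where
  e : Fin n → Fin 2
  e k = if does (i ≟ k) then suc zero else zero
  v = tabulate e
  vi : lookup v i ≡ suc zero
  vi rewrite lookup∘tabulate e i | dec-true (i ≟ i) refl = refl
  unique : ∀ {k} → lookup v k ≡ suc zero → i ≡ k
  unique {k} vk rewrite lookup∘tabulate e k with i ≟ k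
  ... | yes i≡k = i≡k

-- Minimality

module _ (f : Vec (Fin β) j → Vec (Fin 2) n) (f∈U : ∀ x → U n (f x)) where

  private
    W = inputWindow f

    _HasOneAt_ : Vec (Fin β) j → Fin n → Set
    x HasOneAt i = lookup (f x) i ≡ suc zero

    transfer : ∀ {i} u v → Agree (W i) u v → u HasOneAt i → v HasOneAt i
    transfer {i} u v u≈v ui = trans (sym (window-determines f i u v u≈v)) ui

  -- When only `b` and `c` see `V = W b ∩ W c`, rewriting `V` goes unnoticed by all other
  -- coordinates; this leads to an input `D` with a 1 at both `b` and `c`.
  ¬private-overlap : ∀ {x y w} → x HasOneAt b → y HasOneAt c → w HasOneAt a →
    a ≢ b → a ≢ c → b ≢ c →
    ¬ (∀ {k i} → k ∈ W b → k ∈ W c → k ∈ W i → i ≡ b ⊎ i ≡ c)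
  ¬private-overlap {b = b} {c} {a} {x} {y} {w} xb yc wa a≢b a≢c b≢c private-V =
    b≢c (U-injective (f D) (f∈U D) Db Dc)
    where
    V = W b ∩ W c
    -- `A′` is `w` with `x` on `W b` outside `V` and `y` on `V`. It looks like `w′` to `c`, like `D`
    -- to `b`, and like `A` to every other coordinate.
    w′ = merge V y w
    A  = merge (W b) x w
    A′ = merge V y A
    D  = merge (W c) y x

    outside-V : ∀ {i k} → i ≢ b → i ≢ c → k ∈ W i → k ∉ V
    outside-V i≢b i≢c k∈Wi k∈V with x∈p∩q⁻ (W b) (W c) k∈V
    ... | k∈Wb , k∈Wc = [ i≢b , i≢c ] (private-V k∈Wb k∈Wc k∈Wi)

    w′a : w′ HasOneAt a
    w′a = transfer w w′ (λ k k∈Wa → sym (lookup-merge-∉ y w (outside-V a≢b a≢c k∈Wa))) wa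

    Ab : A HasOneAt b
    Ab = transfer x A (λ k k∈Wb → sym (lookup-merge-∈ x w k∈Wb)) xb

    Dc : D HasOneAt c
    Dc = transfer y D (λ k k∈Wc → sym (lookup-merge-∈ y x k∈Wc)) yc

    A′≈w′ : Agree (W c) A′ w′
    A′≈w′ k k∈Wc with k ∈? W b
    ... | yes k∈Wb = trans (lookup-merge-∈ y A k∈V) (sym (lookup-merge-∈ y w k∈V))
      where k∈V = x∈p∩q⁺ (k∈Wb , k∈Wc)
    ... | no  k∉Wb = begin
      lookup A′ k ≡⟨ lookup-merge-∉ y A k∉V ⟩
      lookup A k  ≡⟨ lookup-merge-∉ x w k∉Wb ⟩
      lookup w k  ≡⟨ lookup-merge-∉ y w k∉V ⟨
      lookup w′ k ∎
      where
      open ≡-Reasoning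
      k∉V = k∉Wb ∘ proj₁ ∘ x∈p∩q⁻ (W b) (W c)

    A′≈D : Agree (W b) A′ D
    A′≈D k k∈Wb with k ∈? W c
    ... | yes k∈Wc = trans (lookup-merge-∈ y A (x∈p∩q⁺ (k∈Wb , k∈Wc))) (sym (lookup-merge-∈ y x k∈Wc))
    ... | no  k∉Wc = begin
      lookup A′ k ≡⟨ lookup-merge-∉ y A (k∉Wc ∘ proj₂ ∘ x∈p∩q⁻ (W b) (W c)) ⟩
      lookup A k  ≡⟨ lookup-merge-∈ x w k∈Wb ⟩
      lookup x k  ≡⟨ lookup-merge-∉ y x k∉Wc ⟨
      lookup D k  ∎
      where open ≡-Reasoning

    A′b : A′ HasOneAt b
    -- A 1 at `c` would persist in `w′`, whose 1 is at `a`; a 1 at any `i` other than `b` and `c`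
    -- would persist in `A`, whose 1 is at `b`.
    A′b with f∈U A′
    ... | i , A′i , _ with i ≟ b | i ≟ c
    ...   | yes refl | _        = A′i
    ...   | no  _    | yes refl = contradiction (U-injective (f w′) (f∈U w′) w′a (transfer A′ w′ A′≈w′ A′i)) a≢c
    ...   | no  i≢b  | no  i≢c  = contradiction (sym (U-injective (f A) (f∈U A) Ab (transfer A′ A A′≈A A′i))) i≢b
      where
      A′≈A : Agree (W i) A′ A
      A′≈A k k∈Wi = lookup-merge-∉ y A (outside-V i≢b i≢c k∈Wi)

    Db : D HasOneAt b
    Db = transfer A′ D A′≈D A′b

module _ {n} (a : Fin n) (K : Complex n) (isKₐ : IsKₐ a K) where

  triple-simplex : ∀ {S} → IsTriple a S → Simplex K S
  triple-simplex {S} = proj₁ ∘ Equivalence.from (isKₐ S)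

  ¬¬⊆triple : ∀ {S} → Simplex K S → ¬ ¬ ∃ λ T → IsTriple a T × S ⊆ T
  ¬¬⊆triple sS none = ¬¬maximal-above K sS λ (T , T-max , S⊆T) →
    none (T , Equivalence.to (isKₐ T) T-max , S⊆T)

  -- A triple has only two vertices besides `a`, too few for three distinct ones.
  ¬three-simplex-off-apex : ∀ {b c i} → b ≢ a → c ≢ a → i ≢ a → b ≢ c → i ≢ b → i ≢ c →
    ¬ Simplex K (⁅ b ⁆ ∪ ⁅ c ⁆ ∪ ⁅ i ⁆)
  ¬three-simplex-off-apex {b} {c} {i} b≢a c≢a i≢a b≢c i≢b i≢c s = ¬¬⊆triple s not-below-triple
    where
    pigeonhole : ∀ {d e} → b ≡ d ⊎ b ≡ e → c ≡ d ⊎ c ≡ e → ¬ (i ≡ d ⊎ i ≡ e)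
    pigeonhole (inj₁ refl) (inj₁ refl) _           = b≢c refl
    pigeonhole (inj₂ refl) (inj₂ refl) _           = b≢c refl
    pigeonhole (inj₁ refl) (inj₂ _)    (inj₁ i≡b)  = i≢b i≡b
    pigeonhole (inj₁ _)    (inj₂ refl) (inj₂ i≡c)  = i≢c i≡c
    pigeonhole (inj₂ _)    (inj₁ refl) (inj₁ i≡c)  = i≢c i≡c
    pigeonhole (inj₂ refl) (inj₁ _)    (inj₂ i≡b)  = i≢b i≡b

    not-below-triple : ¬ ∃ λ T → IsTriple a T × ⁅ b ⁆ ∪ ⁅ c ⁆ ∪ ⁅ i ⁆ ⊆ T
    not-below-triple (_ , (d , e , _ , _ , _ , refl) , S⊆T) =
      pigeonhole (choice b≢a (inj₁ refl)) (choice c≢a (inj₂ (inj₁ refl))) (choice i≢a (inj₂ (inj₂ refl)))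
      where
      choice : ∀ {l} → l ≢ a → l ≡ b ⊎ l ≡ c ⊎ l ≡ i → l ≡ d ⊎ l ≡ e
      choice l≢a l∈ = [ (λ l≡a → contradiction l≡a l≢a) , id ] (∈-triple⁻ (S⊆T (∈-triple⁺ l∈)))

  module _ (f : Vec (Fin β) j → Vec (Fin 2) n) (image : HasImage f (U n))
           (K_f≤K : communicationComplex f ≤ᶜ K) where

    private
      W = inputWindow f

      f∈U : ∀ x → U n (f x)
      f∈U x = Equivalence.from (image (f x)) (x , refl)

      preimage : ∀ i → ∃ λ x → lookup (f x) i ≡ suc zero
      preimage i with indicator i
      ... | v , vi , Uv with Equivalence.to (image v) Uv
      ...   | x , refl = x , vi

      seen-by-all : ∀ {b c i k} → k ∈ W b → k ∈ W c → k ∈ W i →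
                    Simplex (communicationComplex f) (⁅ b ⁆ ∪ ⁅ c ⁆ ∪ ⁅ i ⁆)
      seen-by-all {k = k} k∈b k∈c k∈i _ = k , λ l l∈ →
        [ (λ where refl → k∈b) , [ (λ where refl → k∈c) , (λ where refl → k∈i) ] ] (∈-triple⁻ l∈)

    triples-communicate : ∀ {T} → IsTriple a T → Simplex (communicationComplex f) T
    triples-communicate (b , c , b≢a , c≢a , b≢c , refl) = communication-stable f λ abc∉K_f →
      ¬private-overlap f f∈U (proj₂ (preimage b)) (proj₂ (preimage c)) (proj₂ (preimage a))
        (b≢a ∘ sym) (c≢a ∘ sym) b≢c λ {k} {i} k∈b k∈c k∈i → seen-by-b-c abc∉K_f k∈b k∈c k∈i
      where
      seen-by-b-c : ¬ Simplex (communicationComplex f) (⁅ a ⁆ ∪ ⁅ b ⁆ ∪ ⁅ c ⁆) →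
                    ∀ {k i} → k ∈ W b → k ∈ W c → k ∈ W i → i ≡ b ⊎ i ≡ c
      -- A third observer `i` of `k` is excluded: `i ≡ a` would make the triple a simplex of K_f,
      -- and any other `i` would give a simplex of `K` with three vertices off `a`.
      seen-by-b-c abc∉K_f {k} {i} k∈b k∈c k∈i with i ≟ b | i ≟ c | i ≟ a
      ... | yes i≡b | _       | _        = inj₁ i≡b
      ... | no  _   | yes i≡c | _        = inj₂ i≡c
      ... | no  _   | no  _   | yes refl = contradiction (seen-by-all k∈i k∈b k∈c) abc∉K_f
      ... | no  i≢b | no  i≢c | no  i≢a  = contradiction (K_f≤K (seen-by-all k∈b k∈c k∈i))
        (¬three-simplex-off-apex b≢a c≢a i≢a b≢c i≢b i≢c)

    K≤K_f : K ≤ᶜ communicationComplex f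
    K≤K_f sS = communication-stable f λ S∉K_f → ¬¬⊆triple sS λ (_ , tT , S⊆T) →
      S∉K_f (closed (communicationComplex f) S⊆T (triples-communicate tT))

-- A generating function

module Election {n} (a : Fin n) where

  -- The `n * n` positions encode ordered pairs through `combine`. Diagonal pairs and pairs
  -- involving `a` are kept for uniformity.
  Ballots = Vec (Fin n) (n * n)

  ballot : Ballots → Fin n → Fin n → Fin n
  ballot x b c = lookup x (combine b c)

  Wins : Ballots → Fin n → Set
  Wins x b = ∀ c → ballot x b c ≡ b × ballot x c b ≡ b

  Challenger : Ballots → Fin n → Set
  Challenger x b = b ≢ a × Wins x b

  Elected : Ballots → Fin n → Set
  Elected x i = (i ≡ a × ¬ ∃ (Challenger x)) ⊎ Challenger x i

  challenger? : ∀ x i → Dec (Challenger x i)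
  challenger? x i = ¬? (i ≟ a) ×-dec all? λ c → (ballot x i c ≟ i) ×-dec (ballot x c i ≟ i)

  elected? : ∀ x i → Dec (Elected x i)
  elected? x i = ((i ≟ a) ×-dec ¬? (any? (challenger? x))) ⊎-dec challenger? x i

  bit : Bool → Fin 2
  bit t = if t then suc zero else zero

  bit-does : {P : Set} (P? : Dec P) → bit (does P?) ≡ suc zero → P
  bit-does (yes p) _ = p

  elect : Ballots → Vec (Fin 2) n
  elect x = tabulate λ i → bit (does (elected? x i))

  lookup-elect : ∀ x i → lookup (elect x) i ≡ bit (does (elected? x i))
  lookup-elect x = lookup∘tabulate _

  elected⇒one : ∀ x {i} → Elected x i → lookup (elect x) i ≡ suc zero
  elected⇒one x {i} el = trans (lookup-elect x i) (cong bit (dec-true (elected? x i) el))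

  one⇒elected : ∀ x {i} → lookup (elect x) i ≡ suc zero → Elected x i
  one⇒elected x {i} e = bit-does (elected? x i) (trans (sym (lookup-elect x i)) e)

  elected-unique : ∀ x {i k} → Elected x i → Elected x k → i ≡ k
  elected-unique x (inj₁ (refl , _))  (inj₁ (refl , _))  = refl
  elected-unique x (inj₁ (_ , none))  (inj₂ ch)          = contradiction (_ , ch) none
  elected-unique x (inj₂ ch)          (inj₁ (_ , none))  = contradiction (_ , ch) none
  -- The ballot of the pair `(i , k)` equals `i` because `i` wins and `k` because `k` wins.
  elected-unique x (inj₂ (_ , wins-i)) (inj₂ (_ , wins-k)) = trans (sym (proj₁ (wins-i _))) (proj₂ (wins-k _))

  ∃-elected : ∀ x → ∃ (Elected x)
  ∃-elected x with any? (challenger? x)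
  ... | yes (b , ch) = b , inj₂ ch
  ... | no  none     = a , inj₁ (refl , none)

  elect∈U : ∀ x → U n (elect x)
  elect∈U x with ∃-elected x
  ... | w , el = w , elected⇒one x el , elected-unique x el ∘ one⇒elected x

  -- Constant ballots elect each candidate in turn, which gives surjectivity onto `U n`. For `i ≡ a`
  -- a challenger `b` would need its diagonal ballot, which is `a`, to equal `b`.
  unanimous : ∀ i → Elected (replicate (n * n) i) i
  unanimous i with i ≟ a
  ... | no i≢a = inj₂ (i≢a , λ c → lookup-replicate (combine i c) i , lookup-replicate (combine c i) i)
  ... | yes i≡a = inj₁ (i≡a , λ (b , b≢a , wins) →
    b≢a (trans (trans (sym (proj₁ (wins b))) (lookup-replicate (combine b b) i)) i≡a))

  elect-image : HasImage elect (U n)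
  elect-image v = mk⇔ to λ where (x , refl) → elect∈U x
    where
    to : U n v → ∃ λ x → elect x ≡ v
    to Uv@(i , vi , _) = x , U-determined (elect∈U x) Uv (elected⇒one x (unanimous i)) vi
      where x = replicate (n * n) i

  agree-except : ∀ b c x y → Agree (∁ ⁅ combine b c ⁆) x y →
                 ∀ d e → d ≢ b ⊎ e ≢ c → ballot x d e ≡ ballot y d e
  agree-except b c x y x≈y d e d≢b⊎e≢c = x≈y (combine d e) (x∉p⇒x∈∁p λ de∈ →
    let de≡bc = x∈⁅y⁆⇒x≡y _ de∈ in
    [ (λ d≢b → d≢b (combine-injectiveˡ d e b c de≡bc)) , (λ e≢c → e≢c (combine-injectiveʳ d e b c de≡bc)) ] d≢b⊎e≢c)

  -- The challenge of `i` reads only ballots of pairs containing `i`, and `(b , c)` is not one of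
  -- them.
  challenger-cong : ∀ {b c i} x y → i ≢ b → i ≢ c → Agree (∁ ⁅ combine b c ⁆) x y →
                    Challenger x i → Challenger y i
  challenger-cong {b} {c} {i} x y i≢b i≢c x≈y (i≢a , wins) = i≢a , λ d →
    trans (sym (agree-except b c x y x≈y i d (inj₁ i≢b))) (proj₁ (wins d)) ,
    trans (sym (agree-except b c x y x≈y d i (inj₂ i≢c))) (proj₂ (wins d))

  ballot-seen-by : ∀ b c {i} → combine b c ∈ inputWindow elect i → i ≡ a ⊎ i ≡ b ⊎ i ≡ c
  ballot-seen-by b c {i} k∈ with i ≟ a | i ≟ b | i ≟ c
  ... | yes i≡a | _       | _       = inj₁ i≡a
  ... | no _    | yes i≡b | _       = inj₂ (inj₁ i≡b)
  ... | no _    | no _    | yes i≡c = inj₂ (inj₂ i≡c)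
  ... | no i≢a  | no i≢b  | no i≢c  = contradiction k∈ (∉-window elect determined)
    where
    elected-cong : ∀ x y → Agree (∁ ⁅ combine b c ⁆) x y → Elected x i → Elected y i
    elected-cong x y x≈y (inj₁ (i≡a , _)) = contradiction i≡a i≢a
    elected-cong x y x≈y (inj₂ ch)        = inj₂ (challenger-cong x y i≢b i≢c x≈y ch)
    determined : Determines elect i (∁ ⁅ combine b c ⁆)
    determined x y x≈y = begin
      lookup (elect x) i          ≡⟨ lookup-elect x i ⟩
      bit (does (elected? x i))   ≡⟨ cong bit (does-⇔ x-elected⇔y-elected (elected? x i) (elected? y i)) ⟩
      bit (does (elected? y i))   ≡⟨ lookup-elect y i ⟨
      lookup (elect y) i          ∎
      where
      open ≡-Reasoning
      x-elected⇔y-elected = mk⇔ (elected-cong x y x≈y) (elected-cong y x λ k k∈ → sym (x≈y k k∈))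

  elect-communication : 3 ≤ n → ∀ K → IsKₐ a K → communicationComplex elect ≤ᶜ K
  elect-communication 3≤n K isKₐ {S} s with nonempty? S
  -- The empty simplex comes with no common ballot and is treated apart.
  ... | no  empty = closed K (λ i∈S → contradiction (_ , i∈S) empty) (∅-simplex K)
  ... | yes ne with s ne
  ...   | k , seen =
    let b , c = remQuot {n} n k
        T , tT , abc⊆T = triple-containing 3≤n a b c
        bc-seen : ∀ {i} → i ∈ S → combine b c ∈ inputWindow elect i
        bc-seen i∈S = subst (_∈ inputWindow elect _) (sym (combine-remQuot {n} n k)) (seen _ i∈S)
    in closed K (λ i∈S → abc⊆T (∈-triple⁺ (ballot-seen-by b c (bc-seen i∈S)))) (triple-simplex a K isKₐ tT)

proposition4p2 : (n : ℕ) → 3 ≤ n → (a : Fin n) (K : Complex n) → IsKₐ a K → IsMinimalGenerating K (U n)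
proposition4p2 n 3≤n a K isKₐ =
  (n , n * n , elect , elect-image , elect-communication 3≤n K isKₐ) ,
  λ K′ (K′≤K , K≰K′) (_ , _ , f , image , K_f≤K′) →
    -- Since K_f lies below `K`, it contains all of `K`; as it also lies below `K′`, the inclusion
    -- of `K′` in `K` cannot be strict.
    K≰K′ (K_f≤K′ ∘ K≤K_f a K isKₐ f image (K′≤K ∘ K_f≤K′))
  where open Election a
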